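{- For any execution trace of the engine CPS $\mathit{Eng}$ defined in the context (with $\delta=0.4$, $\epsilon=0.1$): \begin{itemize} \item whenever $\mathit{Eng}$ turns on the cooling (i.e. performs the write of $\mathsf{on}$ on the actuator $\mathit{cool}$), the value of the state variable $\mathit{temp}$ lies in $(10-\epsilon,\ 11+\epsilon+\delta]$; \item whenever $\mathit{Eng}$ turns off the cooling (i.e. performs the write of $\mathsf{off}$ on the actuator $\mathit{cool}$), the value of the state variable $\mathit{temp}$ lies in $(10-\epsilon-5(1+\delta),\ 11+\epsilon+\delta-5(1-\delta)]$. \end{itemize}
   Context: An execution trace of $\mathit{Eng}$ is a finite sequence of transitions $\mathit{Eng}\xrightarrow{\alpha_1}\cdots\xrightarrow{\alpha_n}\mathit{Eng}'$ in the labelled transition system below. **Names and values.** There are sets of state variables $\mathcal{X}$, channels $\mathcal{C}$, actuators $\mathcal{A}$ and sensors $\mathcal{S}$. Values $v$ are built from basic values (Booleans, integers, real numbers) and also include names. For a set of names $\mathcal{N}$, $\mathbb{R}^{\mathcal{N}}$ is the set of functions $\mathcal{N}\to\mathbb{R}$, ordered pointwise; $\xi[n\mapsto v]$ is $\xi$ updated at $n$ to $v$. **Physical environment.** Given $\hat{\mathcal{X}}\subseteq\mathcal{X}$, $\hat{\mathcal{A}}\subseteq\mathcal{A}$, $\hat{\mathcal{S}}\subseteq\mathcal{S}$, a physical environment is a 7-tuple $E=\langle \xi_x,\xi_u,\xi_w,\mathit{evol},\xi_e,\mathit{meas},\mathit{inv}\rangle$ of total functions: state function $\xi_x\in\mathbb{R}^{\hat{\mathcal{X}}}$,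 actuator function $\xi_u\in\mathbb{R}^{\hat{\mathcal{A}}}$, uncertainty function $\xi_w\in\mathbb{R}^{\hat{\mathcal{X}}}$, evolution map $\mathit{evol}:\mathbb{R}^{\hat{\mathcal{X}}}\times\mathbb{R}^{\hat{\mathcal{A}}}\times\mathbb{R}^{\hat{\mathcal{X}}}\to 2^{\mathbb{R}^{\hat{\mathcal{X}}}}$, sensor-error function $\xi_e\in\mathbb{R}^{\hat{\mathcal{S}}}$, measurement map $\mathit{meas}:\mathbb{R}^{\hat{\mathcal{X}}}\times\mathbb{R}^{\hat{\mathcal{S}}}\to 2^{\mathbb{R}^{\hat{\mathcal{S}}}}$, invariant function $\mathit{inv}:\mathbb{R}^{\hat{\mathcal{X}}}\to\{\mathsf{true},\mathsf{false}\}$. Operators: $\mathit{read\_sensor}(E,s)=\{\xi(s):\xi\in\mathit{meas}(\xi_x,\xi_e)\}$; $\mathit{update\_act}(E,a,v)$ is $E$ with $\xi_u$ replaced by $\xi_u[a\mapsto v]$; $\mathit{next}(E)$ is the set of environments obtained from $E$ by replacing $\xi_x$ with some $\xi\in\mathit{evol}(\xi_x,\xi_u,\xi_w)$; $\mathit{inv}(E)=\mathit{inv}(\xi_x)$. **Processes.** $P,Q ::= \mathsf{nil} \mid \mathsf{tick}.P \mid P\parallel Q \mid \lfloor\pi.P\rfloor Q \mid \mathsf{if}\,(b)\,\{P\}\,\mathsf{else}\,\{Q\} \mid P\setminus c \mid X \mid \mathsf{fix}\,X.P$, with prefixes $\pi$ among: $\overline{c}\langle v\rangle$ (send $v$ on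 channel $c$), $c(x)$ (receive on $c$), $\mathsf{read}\,s(x)$ (read sensor $s$), $\mathsf{write}\,a\langle v\rangle$ (write $v$ on actuator $a$). The variable $x$ is bound in $\lfloor c(x).P\rfloor Q$ and $\lfloor\mathsf{read}\,s(x).P\rfloor Q$ (with scope $P$), and $X$ is bound in $\mathsf{fix}\,X.P$; processes are taken up to $\alpha$-conversion and are closed (no free variables or process variables). In $\mathsf{tick}.Q$ and $\lfloor\pi.P\rfloor Q$ the occurrence of $Q$ is time-guarded; in $\mathsf{fix}\,X.P$ all occurrences of $X$ in $P$ must be time-guarded. Guards $b$ are decidable, and $\mathsf{if}\,(b)\,\{P\}\,\mathsf{else}\,\{Q\}$ is identified with $P$ if $b$ is true and with $Q$ if $b$ is false. $T\{v/x\}$ and $T\{P/X\}$ denote substitution. Abbreviations: $\pi.P$ stands for $\mathsf{fix}\,X.\lfloor\pi.P\rfloor X$ with $X$ not in $P$; $\mathsf{tick}^k.P$ is $k$ consecutive $\mathsf{tick}$ prefixes followed by $P$. **Process transitions** $P\xrightarrow{\lambda}P'$, $\lambda\in\{\mathsf{tick},\tau,\overline{c}v,cv,a!v,s?v\}$, are the least relation such that: $\lfloor\overline{c}\langle v\rangle.P\rfloor Q\xrightarrow{\overline{c}v}P$; $\lfloor c(x).P\rfloor Q\xrightarrow{cv}P\{v/x\}$; $\lfloor\mathsf{write}\,a\langle v\rangle.P\rfloor Q\xrightarrow{a!v}P$; $\lfloor\mathsf{read}\,s(x).P\rfloor Q\xrightarrow{s?v}P\{v/x\}$; if $P\xrightarrow{\overline{c}v}P'$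 and $Q\xrightarrow{cv}Q'$ then $P\parallel Q\xrightarrow{\tau}P'\parallel Q'$ (and symmetrically); if $P\xrightarrow{\lambda}P'$ and $\lambda\ne\mathsf{tick}$ then $P\parallel Q\xrightarrow{\lambda}P'\parallel Q$ (and symmetrically); if $P\xrightarrow{\lambda}P'$ and $\lambda\notin\{cv,\overline{c}v\}$ then $P\setminus c\xrightarrow{\lambda}P'\setminus c$; if $P\{\mathsf{fix}\,X.P/X\}\xrightarrow{\lambda}Q$ then $\mathsf{fix}\,X.P\xrightarrow{\lambda}Q$; $\mathsf{nil}\xrightarrow{\mathsf{tick}}\mathsf{nil}$; $\mathsf{tick}.P\xrightarrow{\mathsf{tick}}P$; $\lfloor\pi.P\rfloor Q\xrightarrow{\mathsf{tick}}Q$; if $P\xrightarrow{\mathsf{tick}}P'$, $Q\xrightarrow{\mathsf{tick}}Q'$ and $P\parallel Q$ has no $\tau$-transition then $P\parallel Q\xrightarrow{\mathsf{tick}}P'\parallel Q'$. **CPSs.** A CPS is $M=E\Join P$, always assumed well-formed: every sensor $s$ mentioned in $P$ is in the domain of $\xi_e$ and every actuator $a$ mentioned in $P$ is in the domain of $\xi_u$. Transitions $M\xrightarrow{\alpha}M'$, $\alpha\in\{\tau,\overline{c}v,cv,\mathsf{tick}\}$, all requiring $\mathit{inv}(E)=\mathsf{true}$: - $E\Join P\xrightarrow{\overline{c}v}E\Join P'$ if $P\xrightarrow{\overline{c}v}P'$; $E\Join P\xrightarrow{cv}E\Join P'$ if $P\xrightarrow{cv}P'$; - (SensRead) $E\Join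 P\xrightarrow{\tau}E\Join P'$ if $P\xrightarrow{s?v}P'$ and $v\in\mathit{read\_sensor}(E,s)$; - (ActWrite) $E\Join P\xrightarrow{\tau}\mathit{update\_act}(E,a,v)\Join P'$ if $P\xrightarrow{a!v}P'$; - (Tau) $E\Join P\xrightarrow{\tau}E\Join P'$ if $P\xrightarrow{\tau}P'$; - (Time) $E\Join P\xrightarrow{\mathsf{tick}}E'\Join P'$ if $P\xrightarrow{\mathsf{tick}}P'$, $E\Join P$ has no $\tau$-transition, and $E'\in\mathit{next}(E)$. **The engine.** $\mathit{Env}=\langle \xi_x,\xi_u,\xi_w,\mathit{evol},\xi_e,\mathit{meas},\mathit{inv}\rangle$ has one state variable $\mathit{temp}$, one actuator $\mathit{cool}$, one sensor $s_t$, and: $\xi_x(\mathit{temp})=0$; $\xi_u(\mathit{cool})=\mathsf{off}$ (actuator values are regarded as elements of $\{\mathsf{on},\mathsf{off}\}$, a real value $\ge0$ standing for $\mathsf{off}$ and $<0$ for $\mathsf{on}$); $\xi_w(\mathit{temp})=\delta=0.4$; $\mathit{evol}(\xi_x^i,\xi_u^i,\xi_w)=\{\xi:\xi(\mathit{temp})=\xi_x^i(\mathit{temp})+\mathit{heat}(\xi_u^i,\mathit{cool})+\gamma,\ \gamma\in[-\delta,+\delta]\}$, where $\mathit{heat}(\xi_u^i,\mathit{cool})=-1$ if $\xi_u^i(\mathit{cool})=\mathsf{on}$ and $+1$ if $\xi_u^i(\mathit{cool})=\mathsf{off}$; $\xi_e(s_t)=\epsilon=0.1$; $\mathit{meas}(\xi_x^i,\xi_e)=\{\xi:\xi(s_t)\in[\xi_x^i(\mathit{temp})-\epsilon,\xi_x^i(\mathit{temp})+\epsilon]\}$;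 $\mathit{inv}(\xi_x)=\mathsf{true}$ iff $0\le\xi_x(\mathit{temp})\le30$. The controller is $$\mathit{Ctrl}=\mathsf{fix}\,X.\,\mathsf{read}\,s_t(x).\,\mathsf{if}\,(x>10)\,\{\mathit{Cooling}\}\,\mathsf{else}\,\{\mathsf{tick}.X\},$$ $$\mathit{Cooling}=\mathsf{write}\,\mathit{cool}\langle\mathsf{on}\rangle.\,\mathsf{fix}\,Y.\,\mathsf{tick}^5.\,\mathsf{read}\,s_t(x).\,\mathsf{if}\,(x>10)\,\{\overline{\mathit{warning}}\langle\mathrm{ID}\rangle.Y\}\,\mathsf{else}\,\{\mathsf{write}\,\mathit{cool}\langle\mathsf{off}\rangle.\mathsf{tick}.X\},$$ where $\mathit{warning}$ is a channel and $\mathrm{ID}$ a value (the engine identifier). $\mathit{Eng}=\mathit{Env}\Join\mathit{Ctrl}$. -}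

module Defs where

open import Data.Bool using (Bool; if_then_else_)
open import Data.Empty using (⊥)
open import Data.Fin using (Fin; zero; suc)
open import Data.Integer using (ℤ; +_)
open import Data.List using (List; []; _∷_; _++_)
open import Data.List.Relation.Unary.All using (All; []; _∷_)
open import Data.Nat as ℕ using (ℕ; zero; suc)
import Data.Nat.Properties as ℕ
open import Data.Product using (∃; ∃-syntax; Σ; _×_; _,_)
open import Data.Rational as ℚ using (ℚ; 0ℚ; ½)
import Data.Rational.Properties as ℚ
open import Data.Unit using (⊤)
open import Function using (_∘_)
open import Level using (0ℓ) renaming (suc to lsuc)
open import Relation.Binary.Definitions using (DecidableEquality)
open import Relation.Binary.PropositionalEquality
open import Relation.Nullary using (¬_; does)
open import Relation.Unary using (Pred; _∈_; ｛_｝)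

-- Real numbers, as Cauchy sequences of rationals.  The reals form a setoid
-- under _≈_; only the additive ordered structure is needed.

IsCauchy : (ℕ → ℚ) → Set
IsCauchy x = ∀ e → 0ℚ ℚ.< e →
  ∃[ N ] (∀ m n → N ℕ.≤ m → N ℕ.≤ n → ℚ.∣ x m ℚ.- x n ∣ ℚ.< e)

record ℝ : Set where
  constructor mkℝ
  field
    seq    : ℕ → ℚ
    cauchy : IsCauchy seq

open ℝ

fromℚ : ℚ → ℝ
fromℚ q .seq _ = q
fromℚ q .cauchy e 0<e = 0 , λ _ _ _ _ →
  subst (ℚ._< e) (cong ℚ.∣_∣ (sym (ℚ.+-inverseʳ q))) 0<e

private
  interchange : ∀ a b c d → (a ℚ.+ b) ℚ.- (c ℚ.+ d) ≡ (a ℚ.- c) ℚ.+ (b ℚ.- d)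
  interchange a b c d = begin
    (a ℚ.+ b) ℚ.- (c ℚ.+ d)            ≡⟨ cong ((a ℚ.+ b) ℚ.+_) (ℚ.neg-distrib-+ c d) ⟩
    (a ℚ.+ b) ℚ.+ (ℚ.- c ℚ.+ ℚ.- d)    ≡⟨ ℚ.+-assoc a b _ ⟩
    a ℚ.+ (b ℚ.+ (ℚ.- c ℚ.+ ℚ.- d))    ≡⟨ cong (a ℚ.+_) (ℚ.+-assoc b _ _) ⟨
    a ℚ.+ ((b ℚ.+ ℚ.- c) ℚ.+ ℚ.- d)    ≡⟨ cong (λ z → a ℚ.+ (z ℚ.+ ℚ.- d)) (ℚ.+-comm b _) ⟩
    a ℚ.+ ((ℚ.- c ℚ.+ b) ℚ.+ ℚ.- d)    ≡⟨ cong (a ℚ.+_) (ℚ.+-assoc (ℚ.- c) b _) ⟩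
    a ℚ.+ (ℚ.- c ℚ.+ (b ℚ.- d))        ≡⟨ ℚ.+-assoc a _ _ ⟨
    (a ℚ.- c) ℚ.+ (b ℚ.- d)            ∎
    where open ≡-Reasoning

  halves : ∀ e → ½ ℚ.* e ℚ.+ ½ ℚ.* e ≡ e
  halves e = trans (sym (ℚ.*-distribʳ-+ e ½ ½)) (ℚ.*-identityˡ e)

  half-pos : ∀ {e} → 0ℚ ℚ.< e → 0ℚ ℚ.< ½ ℚ.* e
  half-pos {e} 0<e = subst (ℚ._< ½ ℚ.* e) (ℚ.*-zeroʳ ½) (ℚ.*-monoʳ-<-pos ½ 0<e)

infixl 6 _+_ _-_
infix  4 _<_ _≤_ _≈_ _>_

_+_ : ℝ → ℝ → ℝ
(x + y) .seq n = seq x n ℚ.+ seq y n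
(x + y) .cauchy e 0<e
  with cauchy x (½ ℚ.* e) (half-pos 0<e) | cauchy y (½ ℚ.* e) (half-pos 0<e)
... | N₁ , p | N₂ , q = N₁ ℕ.⊔ N₂ , λ m n N≤m N≤n → begin-strict
  ℚ.∣ (seq x m ℚ.+ seq y m) ℚ.- (seq x n ℚ.+ seq y n) ∣
    ≡⟨ cong ℚ.∣_∣ (interchange (seq x m) (seq y m) (seq x n) (seq y n)) ⟩
  ℚ.∣ (seq x m ℚ.- seq x n) ℚ.+ (seq y m ℚ.- seq y n) ∣
    ≤⟨ ℚ.∣p+q∣≤∣p∣+∣q∣ (seq x m ℚ.- seq x n) (seq y m ℚ.- seq y n) ⟩
  ℚ.∣ seq x m ℚ.- seq x n ∣ ℚ.+ ℚ.∣ seq y m ℚ.- seq y n ∣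
    <⟨ ℚ.+-mono-<
         (p m n (ℕ.≤-trans (ℕ.m≤m⊔n N₁ N₂) N≤m) (ℕ.≤-trans (ℕ.m≤m⊔n N₁ N₂) N≤n))
         (q m n (ℕ.≤-trans (ℕ.m≤n⊔m N₁ N₂) N≤m) (ℕ.≤-trans (ℕ.m≤n⊔m N₁ N₂) N≤n)) ⟩
  ½ ℚ.* e ℚ.+ ½ ℚ.* e
    ≡⟨ halves e ⟩
  e ∎
  where open ℚ.≤-Reasoning

-_ : ℝ → ℝ
(- x) .seq n = ℚ.- seq x n
(- x) .cauchy e 0<e with cauchy x e 0<e
... | N , p = N , λ m n N≤m N≤n →
  subst (ℚ._< e)
    (trans (sym (ℚ.∣-p∣≡∣p∣ (seq x m ℚ.- seq x n)))
           (cong ℚ.∣_∣ (ℚ.neg-distrib-+ (seq x m) (ℚ.- seq x n))))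
    (p m n N≤m N≤n)

_-_ : ℝ → ℝ → ℝ
x - y = x + (- y)

_<_ : ℝ → ℝ → Set
x < y = ∃[ e ] (0ℚ ℚ.< e × ∃[ N ] (∀ n → N ℕ.≤ n → seq x n ℚ.+ e ℚ.≤ seq y n))

_>_ : ℝ → ℝ → Set
x > y = y < x

_≤_ : ℝ → ℝ → Set
x ≤ y = ¬ (y < x)

_≈_ : ℝ → ℝ → Set
x ≈ y = x ≤ y × y ≤ x

⦅_,_⟧ : ℝ → ℝ → Pred ℝ 0ℓ
⦅ a , b ⟧ x = a < x × x ≤ b

⟦_,_⟧ : ℝ → ℝ → Pred ℝ 0ℓ
⟦ a , b ⟧ x = a ≤ x × x ≤ b

fromℕ : ℕ → ℝ
fromℕ n = fromℚ (+ n ℚ./ 1)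

0ᵣ 1ᵣ : ℝ
0ᵣ = fromℕ 0
1ᵣ = fromℕ 1

infixl 7 _·_

_·_ : ℕ → ℝ → ℝ
zero  · x = 0ᵣ
suc n · x = x + n · x

record Names : Set₁ where
  field
    StateVar Channel Actuator Sensor : Set
    _≟_ : DecidableEquality Actuator

module Calculus (names : Names) where

  open Names names public

  data Value : Set where
    bool     : Bool → Value
    int      : ℤ → Value
    real     : ℝ → Value
    stateVar : StateVar → Value
    channel  : Channel → Value
    actuator : Actuator → Value
    sensor   : Sensor → Value

  -- Total real functions on a subset; irrelevance of the membership proof
  -- makes the value depend on the name only.
  ℝ^_ : ∀ {A : Set} → Pred A 0ℓ → Set
  ℝ^ N = ∀ n → .(n ∈ N) → ℝ

  -- Truth values and subsets are rendered by Set-valued predicates: the order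
  -- of ℝ is not decidable, so a Bool-valued inv could not be defined.
  record PhysEnv (X̂ : Pred StateVar 0ℓ) (Â : Pred Actuator 0ℓ) (Ŝ : Pred Sensor 0ℓ) : Set₁ where
    field
      ξx   : ℝ^ X̂
      ξu   : ℝ^ Â
      ξw   : ℝ^ X̂
      evol : ℝ^ X̂ → ℝ^ Â → ℝ^ X̂ → Pred (ℝ^ X̂) 0ℓ
      ξe   : ℝ^ Ŝ
      meas : ℝ^ X̂ → ℝ^ Ŝ → Pred (ℝ^ Ŝ) 0ℓ
      inv  : Pred (ℝ^ X̂) 0ℓ

  module _ {X̂ : Pred StateVar 0ℓ} {Â : Pred Actuator 0ℓ} {Ŝ : Pred Sensor 0ℓ} where

    open PhysEnv

    _[_↦_] : ℝ^ Â → Actuator → ℝ → ℝ^ Â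
    (ξ [ a ↦ r ]) b b∈Â = if does (b ≟ a) then r else ξ b b∈Â

    read-sensor : PhysEnv X̂ Â Ŝ → Sensor → Pred ℝ 0ℓ
    read-sensor E s r =
      Σ (s ∈ Ŝ) λ s∈Ŝ → ∃[ ξ ] (ξ ∈ meas E (ξx E) (ξe E) × ξ s s∈Ŝ ≈ r)

    update-act : PhysEnv X̂ Â Ŝ → Actuator → ℝ → PhysEnv X̂ Â Ŝ
    update-act E a r = record E { ξu = ξu E [ a ↦ r ] }

    next : PhysEnv X̂ Â Ŝ → Pred (PhysEnv X̂ Â Ŝ) (lsuc 0ℓ)
    next E E′ = ∃[ ξ ] (ξ ∈ evol E (ξx E) (ξu E) (ξw E) × E′ ≡ record E { ξx = ξ })

    invariant : PhysEnv X̂ Â Ŝ → Set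
    invariant E = inv E (ξx E)

  -- Processes, with de Bruijn indices: `Proc n m` has n free value variables
  -- and m free process variables.

  data Expr (n : ℕ) : Set where
    var : Fin n → Expr n
    lit : Value → Expr n

  eval : ∀ {n} → (Fin n → Value) → Expr n → Value
  eval ρ (var i) = ρ i
  eval ρ (lit v) = v

  -- A guard denotes a truth value for each valuation of its free variables.
  Guard : ℕ → Set₁
  Guard n = (Fin n → Value) → Set

  -- The second index is the number of value variables bound by the prefix.
  data Prefix (n : ℕ) : ℕ → Set where
    send  : Channel → Expr n → Prefix n 0
    recv  : Channel → Prefix n 1
    read  : Sensor → Prefix n 1
    write : Actuator → Expr n → Prefix n 0

  data Proc (n m : ℕ) : Set₁ where
    nil    : Proc n m
    tick∙_ : Proc n m → Proc n m
    _∥_    : Proc n m → Proc n m → Proc n m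
    ⌊_∙_⌋_ : ∀ {k} → Prefix n k → Proc (k ℕ.+ n) m → Proc n m → Proc n m
    ifᵖ    : Guard n → Proc n m → Proc n m → Proc n m
    _∖_    : Proc n m → Channel → Proc n m
    pvar   : Fin m → Proc n m
    fix    : Proc n (suc m) → Proc n m

  infixr 8 tick∙_
  infixl 5 _∥_
  infixl 7 _∖_
  infixr 8 ⌊_∙_⌋_

  Process : Set₁
  Process = Proc 0 0

  lift : ∀ {n n′} k → (Fin n → Fin n′) → Fin (k ℕ.+ n) → Fin (k ℕ.+ n′)
  lift zero    ρ i       = ρ i
  lift (suc k) ρ zero    = zero
  lift (suc k) ρ (suc i) = suc (lift k ρ i)

  weaken : ∀ {n} k → Fin n → Fin (k ℕ.+ n)
  weaken zero    i = i
  weaken (suc k) i = suc (weaken k i)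

  liftᵉ : ∀ {n n′} k → (Fin n → Expr n′) → Fin (k ℕ.+ n) → Expr (k ℕ.+ n′)

  substᵉ : ∀ {n n′} → (Fin n → Expr n′) → Expr n → Expr n′
  substᵉ σ (var i) = σ i
  substᵉ σ (lit v) = lit v

  liftᵉ zero    σ i       = σ i
  liftᵉ (suc k) σ zero    = var zero
  liftᵉ (suc k) σ (suc i) = substᵉ (var ∘ suc) (liftᵉ k σ i)

  substᵍ : ∀ {n n′} → (Fin n → Expr n′) → Guard n → Guard n′
  substᵍ σ b ρ = b (λ i → eval ρ (σ i))

  substᵖʳ : ∀ {n n′ k} → (Fin n → Expr n′) → Prefix n k → Prefix n′ k
  substᵖʳ σ (send c e)  = send c (substᵉ σ e)
  substᵖʳ σ (recv c)    = recv c
  substᵖʳ σ (read s)    = read s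
  substᵖʳ σ (write a e) = write a (substᵉ σ e)

  substᵛ : ∀ {n n′ m} → (Fin n → Expr n′) → Proc n m → Proc n′ m
  substᵛ σ nil                 = nil
  substᵛ σ (tick∙ P)           = tick∙ substᵛ σ P
  substᵛ σ (P ∥ Q)             = substᵛ σ P ∥ substᵛ σ Q
  substᵛ σ (⌊_∙_⌋_ {k} π P Q)  = ⌊ substᵖʳ σ π ∙ substᵛ (liftᵉ k σ) P ⌋ substᵛ σ Q
  substᵛ σ (ifᵖ b P Q)         = ifᵖ (substᵍ σ b) (substᵛ σ P) (substᵛ σ Q)
  substᵛ σ (P ∖ c)             = substᵛ σ P ∖ c
  substᵛ σ (pvar X)            = pvar X
  substᵛ σ (fix P)             = fix (substᵛ σ P)

  renameᵖ : ∀ {n m m′} → (Fin m → Fin m′) → Proc n m → Proc n m′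
  renameᵖ ρ nil           = nil
  renameᵖ ρ (tick∙ P)     = tick∙ renameᵖ ρ P
  renameᵖ ρ (P ∥ Q)       = renameᵖ ρ P ∥ renameᵖ ρ Q
  renameᵖ ρ (⌊ π ∙ P ⌋ Q) = ⌊ π ∙ renameᵖ ρ P ⌋ renameᵖ ρ Q
  renameᵖ ρ (ifᵖ b P Q)   = ifᵖ b (renameᵖ ρ P) (renameᵖ ρ Q)
  renameᵖ ρ (P ∖ c)       = renameᵖ ρ P ∖ c
  renameᵖ ρ (pvar X)      = pvar (ρ X)
  renameᵖ ρ (fix P)       = fix (renameᵖ (lift 1 ρ) P)

  liftᵖ : ∀ {n m m′} → (Fin m → Proc n m′) → Fin (suc m) → Proc n (suc m′)
  liftᵖ σ zero    = pvar zero
  liftᵖ σ (suc X) = renameᵖ suc (σ X)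

  substᵖ : ∀ {n m m′} → (Fin m → Proc n m′) → Proc n m → Proc n m′
  substᵖ σ nil                = nil
  substᵖ σ (tick∙ P)          = tick∙ substᵖ σ P
  substᵖ σ (P ∥ Q)            = substᵖ σ P ∥ substᵖ σ Q
  substᵖ σ (⌊_∙_⌋_ {k} π P Q) =
    ⌊ π ∙ substᵖ (substᵛ (var ∘ weaken k) ∘ σ) P ⌋ substᵖ σ Q
  substᵖ σ (ifᵖ b P Q)        = ifᵖ b (substᵖ σ P) (substᵖ σ Q)
  substᵖ σ (P ∖ c)            = substᵖ σ P ∖ c
  substᵖ σ (pvar X)           = σ X
  substᵖ σ (fix P)            = fix (substᵖ (liftᵖ σ) P)

  _[_]ᵛ : Proc 1 0 → Value → Process
  P [ v ]ᵛ = substᵛ (λ _ → lit v) P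

  _[_]ᵖ : Proc 0 1 → Process → Process
  P [ Q ]ᵖ = substᵖ (λ _ → Q) P

  infixr 8 _∙_

  _∙_ : ∀ {n m k} → Prefix n k → Proc (k ℕ.+ n) m → Proc n m
  π ∙ P = fix (⌊ π ∙ renameᵖ suc P ⌋ pvar zero)

  tick^ : ∀ {n m} → ℕ → Proc n m → Proc n m
  tick^ zero    P = P
  tick^ (suc k) P = tick∙ tick^ k P

  TimeGuarded : ∀ {n m} → Fin m → Proc n m → Set
  TimeGuarded X nil           = ⊤
  TimeGuarded X (tick∙ P)     = ⊤
  TimeGuarded X (P ∥ Q)       = TimeGuarded X P × TimeGuarded X Q
  TimeGuarded X (⌊ π ∙ P ⌋ Q) = TimeGuarded X P
  TimeGuarded X (ifᵖ b P Q)   = TimeGuarded X P × TimeGuarded X Q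
  TimeGuarded X (P ∖ c)       = TimeGuarded X P
  TimeGuarded X (pvar Y)      = X ≢ Y
  TimeGuarded X (fix P)       = TimeGuarded (suc X) P

  FixGuarded : ∀ {n m} → Proc n m → Set
  FixGuarded nil           = ⊤
  FixGuarded (tick∙ P)     = FixGuarded P
  FixGuarded (P ∥ Q)       = FixGuarded P × FixGuarded Q
  FixGuarded (⌊ π ∙ P ⌋ Q) = FixGuarded P × FixGuarded Q
  FixGuarded (ifᵖ b P Q)   = FixGuarded P × FixGuarded Q
  FixGuarded (P ∖ c)       = FixGuarded P
  FixGuarded (pvar X)      = ⊤
  FixGuarded (fix P)       = TimeGuarded zero P × FixGuarded P

  module _ {A : Set} (names-of : ∀ {n k} → Prefix n k → List A) where

    collect : ∀ {n m} → Proc n m → List A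
    collect nil           = []
    collect (tick∙ P)     = collect P
    collect (P ∥ Q)       = collect P ++ collect Q
    collect (⌊ π ∙ P ⌋ Q) = names-of π ++ collect P ++ collect Q
    collect (ifᵖ b P Q)   = collect P ++ collect Q
    collect (P ∖ c)       = collect P
    collect (pvar X)      = []
    collect (fix P)       = collect P

  sensors : ∀ {n m} → Proc n m → List Sensor
  sensors = collect λ { (read s) → s ∷ [] ; _ → [] }

  actuators : ∀ {n m} → Proc n m → List Actuator
  actuators = collect λ { (write a _) → a ∷ [] ; _ → [] }

  -- Process transitions.  The rule for tick on P ∥ Q has a negative premise
  -- about τ, so the relation is defined in two strata: first the labels other
  -- than tick, which never depend on tick, and then tick.
  --
  -- A guard may compare reals, whose order is not decidable, so the
  -- identification of if (b) {P} else {Q} with P or Q is realised by giving the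
  -- conditional the transitions of the selected branch.

  data Label : Set where
    τ     : Label
    send  : Channel → Value → Label
    recv  : Channel → Value → Label
    write : Actuator → Value → Label
    read  : Sensor → Value → Label

  _IsOn_ : Label → Channel → Set
  send c v IsOn d = c ≡ d
  recv c v IsOn d = c ≡ d
  _        IsOn d = ⊥

  ⊨_ : Guard 0 → Set
  ⊨ b = b (λ ())

  infix 3 _—[_]→_ _—tick→_

  data _—[_]→_ : Process → Label → Process → Set₁ where
    outp  : ∀ {c v P Q} → ⌊ send c (lit v) ∙ P ⌋ Q —[ send c v ]→ P
    inpp  : ∀ {c v P Q} → ⌊ recv c ∙ P ⌋ Q —[ recv c v ]→ P [ v ]ᵛ
    write : ∀ {a v P Q} → ⌊ write a (lit v) ∙ P ⌋ Q —[ write a v ]→ P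
    read  : ∀ {s v P Q} → ⌊ read s ∙ P ⌋ Q —[ read s v ]→ P [ v ]ᵛ
    comˡ  : ∀ {c v P P′ Q Q′} → P —[ send c v ]→ P′ → Q —[ recv c v ]→ Q′ →
            P ∥ Q —[ τ ]→ P′ ∥ Q′
    comʳ  : ∀ {c v P P′ Q Q′} → P —[ recv c v ]→ P′ → Q —[ send c v ]→ Q′ →
            P ∥ Q —[ τ ]→ P′ ∥ Q′
    parˡ  : ∀ {l P P′ Q} → P —[ l ]→ P′ → P ∥ Q —[ l ]→ P′ ∥ Q
    parʳ  : ∀ {l P Q Q′} → Q —[ l ]→ Q′ → P ∥ Q —[ l ]→ P ∥ Q′
    res   : ∀ {l c P P′} → P —[ l ]→ P′ → ¬ (l IsOn c) → P ∖ c —[ l ]→ P′ ∖ c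
    rec   : ∀ {l P Q} → P [ fix P ]ᵖ —[ l ]→ Q → fix P —[ l ]→ Q
    then  : ∀ {l b P Q R} → ⊨ b → P —[ l ]→ R → ifᵖ b P Q —[ l ]→ R
    else  : ∀ {l b P Q R} → ¬ (⊨ b) → Q —[ l ]→ R → ifᵖ b P Q —[ l ]→ R

  data _—tick→_ : Process → Process → Set₁ where
    nil     : nil —tick→ nil
    delay   : ∀ {P} → tick∙ P —tick→ P
    timeout : ∀ {k} {π : Prefix 0 k} {P Q} → ⌊ π ∙ P ⌋ Q —tick→ Q
    par     : ∀ {P P′ Q Q′} → P —tick→ P′ → Q —tick→ Q′ →
              ¬ (∃[ R ] (P ∥ Q —[ τ ]→ R)) → P ∥ Q —tick→ P′ ∥ Q′
    res     : ∀ {c P P′} → P —tick→ P′ → P ∖ c —tick→ P′ ∖ c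
    rec     : ∀ {P Q} → P [ fix P ]ᵖ —tick→ Q → fix P —tick→ Q
    then    : ∀ {b P Q R} → ⊨ b → P —tick→ R → ifᵖ b P Q —tick→ R
    else    : ∀ {b P Q R} → ¬ (⊨ b) → Q —tick→ R → ifᵖ b P Q —tick→ R

  data Action : Set where
    τ    : Action
    send : Channel → Value → Action
    recv : Channel → Value → Action
    tick : Action

  module System (X̂ : Pred StateVar 0ℓ) (Â : Pred Actuator 0ℓ) (Ŝ : Pred Sensor 0ℓ) where

    infix 4 _⋈_

    record CPS : Set₁ where
      constructor _⋈_
      field
        env  : PhysEnv X̂ Â Ŝ
        proc : Process

    open CPS public

    record WellFormed (M : CPS) : Set where
      field
        fix-guarded    : FixGuarded (proc M)
        sensors-in-Ŝ   : All (_∈ Ŝ) (sensors (proc M))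
        actuators-in-Â : All (_∈ Â) (actuators (proc M))

    infix 3 _—τ→_ _⟶[_]_ _⟶*[_]_

    -- Stratified like the process transitions, on account of rule (Time).
    data _—τ→_ : CPS → CPS → Set₁ where
      sensRead : ∀ {E P P′ s r} → invariant E →
                 P —[ read s (real r) ]→ P′ → r ∈ read-sensor E s →
                 E ⋈ P —τ→ E ⋈ P′
      actWrite : ∀ {E P P′ a r} → invariant E →
                 P —[ write a (real r) ]→ P′ →
                 E ⋈ P —τ→ update-act E a r ⋈ P′
      tau      : ∀ {E P P′} → invariant E →
                 P —[ τ ]→ P′ → E ⋈ P —τ→ E ⋈ P′

    data _⟶[_]_ : CPS → Action → CPS → Set₁ where
      out  : ∀ {E P P′ c v} → invariant E →
             P —[ send c v ]→ P′ → E ⋈ P ⟶[ send c v ] E ⋈ P′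
      inp  : ∀ {E P P′ c v} → invariant E →
             P —[ recv c v ]→ P′ → E ⋈ P ⟶[ recv c v ] E ⋈ P′
      int  : ∀ {M M′} → M —τ→ M′ → M ⟶[ τ ] M′
      time : ∀ {E E′ P P′} → invariant E →
             P —tick→ P′ → ¬ (∃[ M ] (E ⋈ P —τ→ M)) → E′ ∈ next E →
             E ⋈ P ⟶[ tick ] E′ ⋈ P′

    data _⟶*[_]_ : CPS → List Action → CPS → Set₁ where
      []  : ∀ {M} → M ⟶*[ [] ] M
      _∷_ : ∀ {M α M′ αs M″} → M ⟶[ α ] M′ → M′ ⟶*[ αs ] M″ → M ⟶*[ α ∷ αs ] M″

    infix 4 _∈ᵗ_

    data _∈ᵗ_ {M₁ α M₂} (s : M₁ ⟶[ α ] M₂) : ∀ {M αs M′} → M ⟶*[ αs ] M′ → Set₁ where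
      here  : ∀ {αs M} {t : M₂ ⟶*[ αs ] M} → s ∈ᵗ (s ∷ t)
      there : ∀ {M β M′ αs M″} {s′ : M ⟶[ β ] M′} {t : M′ ⟶*[ αs ] M″} →
              s ∈ᵗ t → s ∈ᵗ (s′ ∷ t)

    data Performs-write (a : Actuator) (r : ℝ) : ∀ {M α M′} → M ⟶[ α ] M′ → Set₁ where
      actWrite : ∀ {E P P′} {i : invariant E} {p : P —[ write a (real r) ]→ P′} →
                 Performs-write a r (int (actWrite {E} i p))

-- Any negative real may serve as `on` and any nonnegative one as `off`.
record EngineSymbols (names : Names) : Set where
  open Calculus names
  field
    temp    : StateVar
    cool    : Actuator
    sₜ      : Sensor
    warning : Channel
    ID      : Value
    on off  : ℝ
    on<0    : on < 0ᵣ
    0≤off   : 0ᵣ ≤ off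

δ ε : ℝ
δ = fromℚ (+ 4 ℚ./ 10)
ε = fromℚ (+ 1 ℚ./ 10)

-- Graph of heat as a function of the value of the actuator cool.
data Heat (u : ℝ) : ℝ → Set where
  when-on  : u < 0ᵣ → Heat u (- 1ᵣ)
  when-off : 0ᵣ ≤ u → Heat u 1ᵣ

module Engine (names : Names) (symbols : EngineSymbols names) where

  open Calculus names public
  open EngineSymbols symbols public
  open System ｛ temp ｝ ｛ cool ｝ ｛ sₜ ｝ public

  Env : PhysEnv ｛ temp ｝ ｛ cool ｝ ｛ sₜ ｝
  Env = record
    { ξx   = λ _ _ → 0ᵣ
    ; ξu   = λ _ _ → off
    ; ξw   = λ _ _ → δ
    ; evol = λ ξx ξu _ ξ → ∃[ h ] ∃[ γ ]
               (Heat (ξu cool refl) h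
                × γ ∈ ⟦ - δ , δ ⟧
                × ξ temp refl ≈ ξx temp refl + h + γ)
    ; ξe   = λ _ _ → ε
    ; meas = λ ξx _ ξ →
               ξ sₜ refl ∈ ⟦ ξx temp refl - ε , ξx temp refl + ε ⟧
    ; inv  = λ ξx → ξx temp refl ∈ ⟦ 0ᵣ , fromℕ 30 ⟧
    }

  -- Values that are not numbers do not exceed anything.
  _>ᵛ_ : Value → ℝ → Set
  real r >ᵛ q = r > q
  int z  >ᵛ q = fromℚ (z ℚ./ 1) > q
  _      >ᵛ q = ⊥

  x>10 : ∀ {n} → Guard (suc n)
  x>10 ρ = ρ zero >ᵛ fromℕ 10

  -- Free process variable: X = pvar zero.  Under fix Y, X is pvar (suc zero).
  Cooling : ∀ {n} → Proc n 1
  Cooling =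
    write cool (lit (real on)) ∙
    fix (tick^ 5 (read sₜ ∙
      ifᵖ x>10
        (send warning (lit ID) ∙ pvar zero)
        (write cool (lit (real off)) ∙ tick∙ pvar (suc zero))))

  Ctrl : Process
  Ctrl = fix (read sₜ ∙ ifᵖ x>10 Cooling (tick∙ pvar zero))

  Eng : CPS
  Eng = Env ⋈ Ctrl

  eng-wellFormed : WellFormed Eng
  eng-wellFormed = record
    { fix-guarded    =
        _ , _ , ((_ , (_ , ((λ ()) , _) , (((λ ()) , _) , _) , _) , _) , _) , _
    ; sensors-in-Ŝ   = refl ∷ refl ∷ []
    ; actuators-in-Â = refl ∷ refl ∷ []
    }

  tempOf : CPS → ℝ
  tempOf M = PhysEnv.ξx (env M) temp refl

{-# OPTIONS --safe #-}
module Submission where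

-- The temperature is at most 11 + ε + δ whenever the sensor is about to be read
-- with the cooling off: a reading not above 10 bounds it by 10 + ε, and the tick
-- before the next reading adds at most 1 + δ.  The cooling is switched on only
-- after a reading above 10, that is, at a temperature above 10 - ε.  Each of the
-- five ticks that follow lowers the temperature by at least 1 - δ and at most
-- 1 + δ, so it is at most 8.5 at the next reading.  That reading is therefore not
-- above 10: no warning is ever sent, and the cooling is switched off at once.
-- Sensor reads and actuator writes are urgent, since both yield a τ-transition of
-- the CPS; this is what keeps time from passing between a reading and a write.
-- A pending warning would not be urgent, so its unreachability matters.

open import Defs
open import Data.List using (List)
open import Data.Product using (_×_; _,_; ∃-syntax; proj₁; proj₂)
open import Data.Sum using (_⊎_; inj₁; inj₂; [_,_]′)
open import Data.Nat as ℕ using (ℕ; zero; suc)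
open import Data.Fin using (zero)
import Data.Nat.Properties as ℕ
open import Data.Rational as ℚ using (ℚ; 0ℚ; 1ℚ; ½)
import Data.Rational.Properties as ℚ
open import Data.Rational.Solver using (module +-*-Solver)
open import Function using (id)
import Relation.Binary.Reasoning.Base.Triple
open import Relation.Binary.Structures using (IsPreorder)
open import Relation.Binary.PropositionalEquality
open import Relation.Nullary using (yes; no; contradiction)
open import Relation.Nullary.Decidable using (from-yes)
open import Relation.Unary using (_∈_; ｛_｝)

open ℝ
open +-*-Solver using (solve; con; _:+_; _:*_; _:-_; :-_; _:=_)

-- Order of the Cauchy reals.

p≤∣p∣ : ∀ p → p ℚ.≤ ℚ.∣ p ∣
p≤∣p∣ p with ℚ.≤-total 0ℚ p
... | inj₁ 0≤p = ℚ.≤-reflexive (sym (ℚ.0≤p⇒∣p∣≡p 0≤p))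
... | inj₂ p≤0 = ℚ.≤-trans p≤0 (ℚ.0≤∣p∣ p)

OscillatesBelow : ℚ → ℝ → ℕ → Set
OscillatesBelow d z N = ∀ m n → N ℕ.≤ m → N ℕ.≤ n → ℚ.∣ seq z m ℚ.- seq z n ∣ ℚ.< d

-- After `N` the difference `y - x` moves by less than `d`, so a gap of `2d` at a single index
-- leaves at least `d` at all later ones.
<-from-gap : ∀ {x y d N} → 0ℚ ℚ.< d →
  OscillatesBelow d (y - x) N →
  ∀ {M} → N ℕ.≤ M → seq x M ℚ.+ (d ℚ.+ d) ℚ.≤ seq y M → x < y
<-from-gap {x} {y} {d} {N} 0<d osc {M} N≤M gap = d , 0<d , N , λ n N≤n →
  begin
    seq x n ℚ.+ d
      ≡⟨ solve 3 (λ d x x′ → x :+ d :=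
           (x′ :+ (d :+ d)) :+ (:- d :+ (x :- x′)))
           refl d (seq x n) (seq x M) ⟩
    (seq x M ℚ.+ (d ℚ.+ d)) ℚ.+ (ℚ.- d ℚ.+ (seq x n ℚ.- seq x M))
      ≤⟨ ℚ.+-mono-≤ gap (ℚ.+-monoˡ-≤ (seq x n ℚ.- seq x M)
           (ℚ.neg-antimono-≤ (ℚ.≤-trans (p≤∣p∣ _) (ℚ.<⇒≤ (osc M n N≤M N≤n))))) ⟩
    seq y M ℚ.+ (ℚ.- (seq (y - x) M ℚ.- seq (y - x) n) ℚ.+ (seq x n ℚ.- seq x M))
      ≡⟨ solve 4 (λ x x′ y y′ →
           y′ :+ (:- ((y′ :- x′) :- (y :- x)) :+ (x :- x′)) := y)
           refl (seq x n) (seq x M) (seq y n) (seq y M) ⟩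
    seq y n ∎
  where open ℚ.≤-Reasoning

quarter : ∀ {e} → 0ℚ ℚ.< e → ∃[ d ] (0ℚ ℚ.< d × (d ℚ.+ d) ℚ.+ (d ℚ.+ d) ≡ e)
quarter {e} 0<e = ¼ ℚ.* e , 0<¼e ,
  trans (solve 1 (λ e → let d = con ¼ :* e in (d :+ d) :+ (d :+ d) := con 1ℚ :* e) refl e)
    (ℚ.*-identityˡ e)
  where
  ¼ = ½ ℚ.* ½
  0<¼e : 0ℚ ℚ.< ¼ ℚ.* e
  0<¼e = subst (ℚ._< ¼ ℚ.* e) (ℚ.*-zeroʳ ¼) (ℚ.*-monoʳ-<-pos ¼ 0<e)

remaining-gap : ∀ x y z d e → (d ℚ.+ d) ℚ.+ (d ℚ.+ d) ≡ e →
  x ℚ.+ e ℚ.≤ z → y ℚ.≤ x ℚ.+ (d ℚ.+ d) → y ℚ.+ (d ℚ.+ d) ℚ.≤ z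
remaining-gap x y z d e 4d≡e x+e≤z y≤x+2d = begin
  y ℚ.+ (d ℚ.+ d)                      ≤⟨ ℚ.+-monoˡ-≤ (d ℚ.+ d) y≤x+2d ⟩
  x ℚ.+ (d ℚ.+ d) ℚ.+ (d ℚ.+ d)        ≡⟨ ℚ.+-assoc x (d ℚ.+ d) (d ℚ.+ d) ⟩
  x ℚ.+ ((d ℚ.+ d) ℚ.+ (d ℚ.+ d))      ≡⟨ cong (x ℚ.+_) 4d≡e ⟩
  x ℚ.+ e                              ≤⟨ x+e≤z ⟩
  z                                    ∎
  where open ℚ.≤-Reasoning

-- The rationals `x + 2d` and `y` are comparable at one late index `M`. As `e = 4d`, either outcome
-- leaves a gap of `2d` there, on one side of `y` or the other.
<-cotrans-fromOscillation : ∀ {x z d e N₀ N₁ N₂} y →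
  0ℚ ℚ.< d → (d ℚ.+ d) ℚ.+ (d ℚ.+ d) ≡ e →
  (∀ n → N₀ ℕ.≤ n → seq x n ℚ.+ e ℚ.≤ seq z n) →
  OscillatesBelow d (y - x) N₁ → OscillatesBelow d (z - y) N₂ → x < y ⊎ y < z
<-cotrans-fromOscillation {x} {z} {d} {e} {N₀} {N₁} {N₂} y 0<d 4d≡e x+e≤z osc₁ osc₂ =
  [ (λ x+2d≤y → inj₁ (<-from-gap {x} {y} 0<d osc₁ N₁≤M x+2d≤y))
  , (λ y≤x+2d → inj₂ (<-from-gap {y} {z} 0<d osc₂ N₂≤M
      (remaining-gap (seq x M) (seq y M) (seq z M) d e 4d≡e
        (x+e≤z M (ℕ.m≤m⊔n N₀ _)) y≤x+2d)))
  ]′ (ℚ.≤-total (seq x M ℚ.+ (d ℚ.+ d)) (seq y M))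
  where
  M = N₀ ℕ.⊔ (N₁ ℕ.⊔ N₂)

  N₁≤M : N₁ ℕ.≤ M
  N₁≤M = ℕ.≤-trans (ℕ.m≤m⊔n N₁ N₂) (ℕ.m≤n⊔m N₀ _)

  N₂≤M : N₂ ℕ.≤ M
  N₂≤M = ℕ.≤-trans (ℕ.m≤n⊔m N₁ N₂) (ℕ.m≤n⊔m N₀ _)

-- A constructive substitute for trichotomy. As `_≤_` is a negated `_<_`, the mixed transitivity
-- laws rest on it.
<-cotrans : ∀ {x z} → x < z → ∀ y → x < y ⊎ y < z
<-cotrans {x} {z} (e , 0<e , N₀ , x+e≤z) y =
  let d  , 0<d , 4d≡e = quarter 0<e
      N₁ , osc₁       = cauchy (y - x) d 0<d
      N₂ , osc₂       = cauchy (z - y) d 0<d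
  in <-cotrans-fromOscillation {x} {z} y 0<d 4d≡e x+e≤z osc₁ osc₂

p<p+q : ∀ p {q} → 0ℚ ℚ.< q → p ℚ.< p ℚ.+ q
p<p+q p {q} 0<q = subst (ℚ._< p ℚ.+ q) (ℚ.+-identityʳ p) (ℚ.+-monoʳ-< p 0<q)

<⇒≤ : ∀ {x y} → x < y → x ≤ y
<⇒≤ {x} {y} (e , 0<e , N , x+e≤y) (f , 0<f , N′ , y+f≤x) =
  ℚ.<-asym
    (ℚ.<-≤-trans (p<p+q (seq x M) 0<e) (x+e≤y M (ℕ.m≤m⊔n N N′)))
    (ℚ.<-≤-trans (p<p+q (seq y M) 0<f) (y+f≤x M (ℕ.m≤n⊔m N N′)))
  where
  M = N ℕ.⊔ N′

-- Both relations unfold during unification, so the points compared are never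
-- inferred and have to be passed explicitly.
<-≤-trans : ∀ {x y z} → x < y → y ≤ z → x < z
<-≤-trans {x} {y} {z} x<y y≤z =
  [ id , (λ z<y → contradiction z<y y≤z) ]′ (<-cotrans {x} {y} x<y z)

≤-<-trans : ∀ {x y z} → x ≤ y → y < z → x < z
≤-<-trans {x} {y} {z} x≤y y<z =
  [ (λ y<x → contradiction y<x x≤y) , id ]′ (<-cotrans {y} {z} y<z x)

≤-trans : ∀ {x y z} → x ≤ y → y ≤ z → x ≤ z
≤-trans {x} {y} {z} x≤y y≤z z<x = y≤z (<-≤-trans {z} {x} {y} z<x x≤y)

seq-≤⇒≤ : ∀ {x y} → (∀ n → seq x n ℚ.≤ seq y n) → x ≤ y
seq-≤⇒≤ {x} {y} x≤y (e , 0<e , N , y+e≤x) =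
  ℚ.<-irrefl refl
    (ℚ.<-≤-trans (p<p+q (seq y N) 0<e) (ℚ.≤-trans (y+e≤x N ℕ.≤-refl) (x≤y N)))

seq-≡⇒≈ : ∀ {x y} → seq x ≗ seq y → x ≈ y
seq-≡⇒≈ {x} {y} x≗y =
  seq-≤⇒≤ {x} {y} (λ n → ℚ.≤-reflexive (x≗y n)) ,
  seq-≤⇒≤ {y} {x} (λ n → ℚ.≤-reflexive (sym (x≗y n)))

≤-isPreorder : IsPreorder _≈_ _≤_
≤-isPreorder = record
  { isEquivalence = record
    { refl  = λ {x} → seq-≡⇒≈ {x} {x} λ _ → refl
    ; sym   = λ (x≤y , y≤x) → y≤x , x≤y
    ; trans = λ {x} {y} {z} (x≤y , y≤x) (y≤z , z≤y) →
        ≤-trans {x} {y} {z} x≤y y≤z , ≤-trans {z} {y} {x} z≤y y≤x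
    }
  ; reflexive = proj₁
  ; trans     = λ {x} {y} {z} → ≤-trans {x} {y} {z}
  }

module ≤-Reasoning = Relation.Binary.Reasoning.Base.Triple
  ≤-isPreorder
  (λ {x} {y} → <⇒≤ {x} {y})
  (λ {x} {y} {z} x<y y<z → <-≤-trans {x} {y} {z} x<y (<⇒≤ {y} {z} y<z))
  ( (λ {x} {y} {z} (y≤z , _) x<y → <-≤-trans {x} {y} {z} x<y y≤z)
  , (λ {x} {y} {z} (_ , z≤y) y<x → ≤-<-trans {z} {y} {x} z≤y y<x))
  (λ {x} {y} → <⇒≤ {x} {y})
  (λ {x} {y} {z} → <-≤-trans {x} {y} {z})
  (λ {x} {y} {z} → ≤-<-trans {x} {y} {z})

-- Addition and order.

+-monoˡ-< : ∀ {x y} z → x < y → x + z < y + z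
+-monoˡ-< {x} {y} z (e , 0<e , N , x+e≤y) = e , 0<e , N , λ n N≤n →
  subst (ℚ._≤ seq (y + z) n)
    (solve 3 (λ x e z → x :+ e :+ z := x :+ z :+ e) refl (seq x n) e (seq z n))
    (ℚ.+-monoˡ-≤ (seq z n) (x+e≤y n N≤n))

+-comm : ∀ x y → x + y ≈ y + x
+-comm x y = seq-≡⇒≈ {x + y} {y + x} λ n → ℚ.+-comm (seq x n) (seq y n)

x+y-y≈x : ∀ x y → x + y - y ≈ x
x+y-y≈x x y = seq-≡⇒≈ {x + y - y} {x} λ n →
  solve 2 (λ x y → x :+ y :- y := x) refl (seq x n) (seq y n)

x-y+y≈x : ∀ x y → x - y + y ≈ x
x-y+y≈x x y = seq-≡⇒≈ {x - y + y} {x} λ n →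
  solve 2 (λ x y → x :- y :+ y := x) refl (seq x n) (seq y n)

-- Monotonicity of addition for `_≤_` is the contrapositive of this.
+-cancelʳ-< : ∀ {x y} z → x + z < y + z → x < y
+-cancelʳ-< {x} {y} z x+z<y+z = begin-strict
  x           ≈⟨ x+y-y≈x x z ⟨
  x + z - z   <⟨ +-monoˡ-< {x + z} {y + z} (- z) x+z<y+z ⟩
  y + z - z   ≈⟨ x+y-y≈x y z ⟩
  y           ∎
  where open ≤-Reasoning

+-monoˡ-≤ : ∀ {x y} z → x ≤ y → x + z ≤ y + z
+-monoˡ-≤ {x} {y} z x≤y y+z<x+z = x≤y (+-cancelʳ-< {y} {x} z y+z<x+z)

+-monoʳ-≤ : ∀ x {y z} → y ≤ z → x + y ≤ x + z
+-monoʳ-≤ x {y} {z} y≤z = begin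
  x + y   ≈⟨ +-comm x y ⟩
  y + x   ≤⟨ +-monoˡ-≤ {y} {z} x y≤z ⟩
  z + x   ≈⟨ +-comm z x ⟩
  x + z   ∎
  where open ≤-Reasoning

x-y≤z⇒x≤z+y : ∀ {x y z} → x - y ≤ z → x ≤ z + y
x-y≤z⇒x≤z+y {x} {y} {z} x-y≤z = begin
  x           ≈⟨ x-y+y≈x x y ⟨
  x - y + y   ≤⟨ +-monoˡ-≤ {x - y} {z} y x-y≤z ⟩
  z + y       ∎
  where open ≤-Reasoning

x<y+z⇒x-z<y : ∀ {x y z} → x < y + z → x - z < y
x<y+z⇒x-z<y {x} {y} {z} x<y+z = begin-strict
  x - z       <⟨ +-monoˡ-< {x} {y + z} (- z) x<y+z ⟩
  y + z - z   ≈⟨ x+y-y≈x y z ⟩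
  y           ∎
  where open ≤-Reasoning

-- Temperature bounds across one tick.

peak : ℝ
peak = fromℕ 11 + ε + δ

-- The band in which the temperature lies k ticks before the end of a cooling phase.
lower upper : ℕ → ℝ
lower zero    = fromℕ 10 - ε - 5 · (1ᵣ + δ)
lower (suc k) = lower k + (1ᵣ + δ)
upper zero    = fromℕ 11 + ε + δ - 5 · (1ᵣ - δ)
upper (suc k) = upper k + (1ᵣ - δ)

module _ {t γ t′ : ℝ} where

  -- The extreme case is `γ = - δ`, a drop of `1 + δ`, which is the step of `lower`.
  cooled-lower : ∀ k → lower (suc k) < t → - δ ≤ γ → t + - 1ᵣ + γ ≤ t′ → lower k < t′
  cooled-lower k lower<t -δ≤γ t-1+γ≤t′ = begin-strict
    lower k                    ≈⟨ seq-≡⇒≈ {lower k} {lower (suc k) + - 1ᵣ + - δ} (λ n →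
                                    solve 3 (λ l a d → l := l :+ (a :+ d) :- a :- d)
                                      refl (seq (lower k) n) (seq 1ᵣ n) (seq δ n)) ⟩
    lower (suc k) + - 1ᵣ + - δ <⟨ +-monoˡ-< {lower (suc k) + - 1ᵣ} {t + - 1ᵣ} (- δ)
                                    (+-monoˡ-< {lower (suc k)} {t} (- 1ᵣ) lower<t) ⟩
    t + - 1ᵣ + - δ             ≤⟨ +-monoʳ-≤ (t + - 1ᵣ) { - δ} {γ} -δ≤γ ⟩
    t + - 1ᵣ + γ               ≤⟨ t-1+γ≤t′ ⟩
    t′                         ∎
    where open ≤-Reasoning

  -- The slowest cooling is `γ = δ`, a drop of `1 - δ`, which is the step of `upper`.
  cooled-upper : ∀ k → t ≤ upper (suc k) → γ ≤ δ → t′ ≤ t + - 1ᵣ + γ → t′ ≤ upper k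
  cooled-upper k t≤upper γ≤δ t′≤t-1+γ = begin
    t′                         ≤⟨ t′≤t-1+γ ⟩
    t + - 1ᵣ + γ               ≤⟨ +-monoʳ-≤ (t + - 1ᵣ) {γ} {δ} γ≤δ ⟩
    t + - 1ᵣ + δ               ≤⟨ +-monoˡ-≤ {t + - 1ᵣ} {upper (suc k) + - 1ᵣ} δ
                                    (+-monoˡ-≤ {t} {upper (suc k)} (- 1ᵣ) t≤upper) ⟩
    upper (suc k) + - 1ᵣ + δ   ≈⟨ seq-≡⇒≈ {upper (suc k) + - 1ᵣ + δ} {upper k} (λ n →
                                    solve 3 (λ u a d → u :+ (a :- d) :- a :+ d := u)
                                      refl (seq (upper k) n) (seq 1ᵣ n) (seq δ n)) ⟩
    upper k                    ∎
    where open ≤-Reasoning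

  heated : ∀ {b} → t ≤ b → γ ≤ δ → t′ ≤ t + 1ᵣ + γ → b + 1ᵣ + δ ≤ peak → t′ ≤ peak
  heated {b} t≤b γ≤δ t′≤t+1+γ b+1+δ≤ = begin
    t′             ≤⟨ t′≤t+1+γ ⟩
    t + 1ᵣ + γ     ≤⟨ +-monoʳ-≤ (t + 1ᵣ) {γ} {δ} γ≤δ ⟩
    t + 1ᵣ + δ     ≤⟨ +-monoˡ-≤ {t + 1ᵣ} {b + 1ᵣ} δ (+-monoˡ-≤ {t} {b} 1ᵣ t≤b) ⟩
    b + 1ᵣ + δ     ≤⟨ b+1+δ≤ ⟩
    peak        ∎
    where open ≤-Reasoning

-- What a sensor reading says about the temperature.

Reading : ℝ → ℝ → Set
Reading t r = r ∈ ⟦ t - ε , t + ε ⟧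

-- Provides a value that the sensor can always return, so that a pending read is always enabled.
exact-reading : ∀ t → Reading t t
exact-reading t =
  seq-≤⇒≤ {t - ε} {t} (λ n → subst (ℚ._≤_ (seq (t - ε) n)) (ℚ.+-identityʳ (seq t n))
    (ℚ.+-monoʳ-≤ (seq t n) (from-yes (ℚ.- seq ε 0 ℚ.≤? 0ℚ)))) ,
  seq-≤⇒≤ {t} {t + ε} (λ n → subst (ℚ._≤ seq (t + ε) n) (ℚ.+-identityʳ (seq t n))
    (ℚ.+-monoʳ-≤ (seq t n) (from-yes (0ℚ ℚ.≤? seq ε 0))))

reading-resp-≈ : ∀ {t r r′} → Reading t r → r ≈ r′ → Reading t r′
reading-resp-≈ {t} {r} {r′} (t-ε≤r , r≤t+ε) (r≤r′ , r′≤r) =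
  ≤-trans {t - ε} {r} {r′} t-ε≤r r≤r′ , ≤-trans {r′} {r} {t + ε} r′≤r r≤t+ε

low-reading : ∀ {t r} → Reading t r → r ≤ fromℕ 10 → t ≤ fromℕ 10 + ε
low-reading {t} {r} (t-ε≤r , _) r≤10 =
  x-y≤z⇒x≤z+y {t} {ε} {fromℕ 10} (≤-trans {t - ε} {r} {fromℕ 10} t-ε≤r r≤10)

high-reading : ∀ {t r} → Reading t r → r > fromℕ 10 → fromℕ 10 - ε < t
high-reading {t} {r} (_ , r≤t+ε) 10<r =
  x<y+z⇒x-z<y {fromℕ 10} {t} {ε} (<-≤-trans {fromℕ 10} {r} {t + ε} 10<r r≤t+ε)

cooled-reading : ∀ {t r} → t ≤ upper 0 → Reading t r → r ≤ fromℕ 10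
cooled-reading {t} {r} t≤upper (_ , r≤t+ε) = begin
  r             ≤⟨ r≤t+ε ⟩
  t + ε         ≤⟨ +-monoˡ-≤ {t} {upper 0} ε t≤upper ⟩
  -- Here 8.6 is compared with 10; both sequences are constant, so index 0 decides.
  upper 0 + ε   ≤⟨ seq-≤⇒≤ {upper 0 + ε} {fromℕ 10}
                     (λ _ → from-yes (seq (upper 0 + ε) 0 ℚ.≤? seq (fromℕ 10) 0)) ⟩
  fromℕ 10      ∎
  where open ≤-Reasoning

-- Control states of the engine and their invariant.

module Behaviour (names : Names) (symbols : EngineSymbols names) where

  open Engine names symbols

  -- Reindexes a closed process for the places under binders to which substitution for a process
  -- variable carries it.
  embed : ∀ {n m} → Process → Proc n m
  embed P = renameᵖ (λ ()) (substᵛ (λ ()) P)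

  -- The derivatives of Ctrl, with the substitutions carried out: Monitor is fix Y
  -- with X replaced by Ctrl, and Decide r and Redecide r are the two conditionals
  -- once the value r has been read.
  Monitor : Process
  Recheck : Process
  Decide Redecide : ℝ → Process

  Monitor = fix (tick^ 5 (read sₜ ∙
    ifᵖ x>10
      (send warning (lit ID) ∙ pvar zero)
      (write cool (lit (real off)) ∙ tick∙ embed Ctrl)))

  Recheck = read sₜ ∙
    ifᵖ x>10
      (send warning (lit ID) ∙ embed Monitor)
      (write cool (lit (real off)) ∙ tick∙ embed Ctrl)

  Decide r = ifᵖ (λ _ → r > fromℕ 10)
    (write cool (lit (real on)) ∙ Monitor)
    (tick∙ Ctrl)

  Redecide r = ifᵖ (λ _ → r > fromℕ 10)
    (send warning (lit ID) ∙ Monitor)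
    (write cool (lit (real off)) ∙ tick∙ Ctrl)

  engine : ℝ^ ｛ temp ｝ → ℝ^ ｛ cool ｝ → PhysEnv ｛ temp ｝ ｛ cool ｝ ｛ sₜ ｝
  engine ξx ξu = record Env { ξx = ξx ; ξu = ξu }

  -- An inductive invariant with one constructor per control point. The sign of the actuator fixes
  -- the direction of the next tick. A pending warning has no constructor.
  data Reachable : CPS → Set₁ where
    sensing      : ∀ {ξx ξu} → 0ᵣ ≤ ξu cool refl → ξx temp refl ≤ peak →
                   Reachable (engine ξx ξu ⋈ Ctrl)
    deciding     : ∀ {ξx ξu r} → 0ᵣ ≤ ξu cool refl → ξx temp refl ≤ peak →
                   Reading (ξx temp refl) r → Reachable (engine ξx ξu ⋈ Decide r)
    monitoring   : ∀ {ξx ξu} → ξu cool refl < 0ᵣ →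
                   ξx temp refl ∈ ⦅ lower 5 , upper 5 ⟧ →
                   Reachable (engine ξx ξu ⋈ Monitor)
    cooling      : ∀ k {ξx ξu} → ξu cool refl < 0ᵣ →
                   ξx temp refl ∈ ⦅ lower k , upper k ⟧ →
                   Reachable (engine ξx ξu ⋈ tick^ k Recheck)
    redeciding   : ∀ {ξx ξu r} → ξu cool refl < 0ᵣ →
                   ξx temp refl ∈ ⦅ lower 0 , upper 0 ⟧ →
                   Reading (ξx temp refl) r → Reachable (engine ξx ξu ⋈ Redecide r)
    switched-off : ∀ {ξx ξu} → 0ᵣ ≤ ξu cool refl → ξx temp refl ≤ upper 0 →
                   Reachable (engine ξx ξu ⋈ tick∙ Ctrl)

  -- The update tests names with `_≟_`, which does not compute on abstract actuators, so
  -- `cool ≟ cool` is split by hand.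
  updated : ∀ (P : ℝ → Set) ξx ξu {r} → P r →
    P (PhysEnv.ξu (update-act (engine ξx ξu) cool r) cool refl)
  updated P _ _ p with cool ≟ cool
  ... | yes _   = p
  ... | no  c≢c = contradiction refl c≢c

  read-sensor⇒Reading : ∀ ξx ξu {s r} →
    r ∈ read-sensor (engine ξx ξu) s → Reading (ξx temp refl) r
  read-sensor⇒Reading ξx _ {r = r} (refl , ξ , reading , ξ≈r) =
    reading-resp-≈ {ξx temp refl} {ξ sₜ refl} {r} reading ξ≈r

  can-read : ∀ ξx ξu → ξx temp refl ∈ read-sensor (engine ξx ξu) sₜ
  can-read ξx ξu = refl , (λ _ _ → t) , exact-reading t , seq-≡⇒≈ {t} {t} λ _ → refl
    where t = ξx temp refl

  heating-step : ∀ {ξx ξu ξ b} → 0ᵣ ≤ ξu cool refl → ξx temp refl ≤ b →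
    b + 1ᵣ + δ ≤ peak → ξ ∈ PhysEnv.evol Env ξx ξu (λ _ _ → δ) → ξ temp refl ≤ peak
  heating-step off t≤b b+1+δ≤ (_ , _ , when-on on , _) = contradiction on off
  heating-step {ξx} {ξ = ξ} {b} off t≤b b+1+δ≤ (_ , γ , when-off _ , (_ , γ≤δ) , (t′≤ , _)) =
    heated {ξx temp refl} {γ} {ξ temp refl} {b} t≤b γ≤δ t′≤ b+1+δ≤

  cooling-step : ∀ {ξx ξu ξ} k → ξu cool refl < 0ᵣ →
    ξx temp refl ∈ ⦅ lower (suc k) , upper (suc k) ⟧ →
    ξ ∈ PhysEnv.evol Env ξx ξu (λ _ _ → δ) → ξ temp refl ∈ ⦅ lower k , upper k ⟧
  cooling-step k on _ (_ , _ , when-off off , _) = contradiction on off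
  cooling-step {ξx} {ξ = ξ} k on (lower<t , t≤upper)
    (_ , γ , when-on _ , (-δ≤γ , γ≤δ) , (t′≤ , ≤t′)) =
    cooled-lower {ξx temp refl} {γ} {ξ temp refl} k lower<t -δ≤γ ≤t′ ,
    cooled-upper {ξx temp refl} {γ} {ξ temp refl} k t≤upper γ≤δ t′≤

  -- Preservation of the invariant by transitions.

  from-sensing : ∀ {ξx ξu α M} → 0ᵣ ≤ ξu cool refl → ξx temp refl ≤ peak →
    engine ξx ξu ⋈ Ctrl ⟶[ α ] M → Reachable M
  from-sensing _ _ (out _ (rec (rec ())))
  from-sensing _ _ (inp _ (rec (rec ())))
  from-sensing _ _ (int (tau _ (rec (rec ()))))
  from-sensing _ _ (int (actWrite _ (rec (rec ()))))
  from-sensing {ξx} {ξu} off t≤ (int (sensRead {r = r} _ (rec (rec read)) r∈)) =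
    deciding {r = r} off t≤ (read-sensor⇒Reading ξx ξu {r = r} r∈)
  from-sensing {ξx} {ξu} _ _ (time inv _ urgent _) =
    -- Reading the exact temperature is a τ-transition, which rule `time` forbids.
    contradiction (_ , sensRead {r = ξx temp refl} inv (rec (rec read)) (can-read ξx ξu)) urgent

  from-deciding : ∀ {ξx ξu r α M} → 0ᵣ ≤ ξu cool refl → ξx temp refl ≤ peak →
    Reading (ξx temp refl) r → engine ξx ξu ⋈ Decide r ⟶[ α ] M → Reachable M
  from-deciding _ _ _ (out _ (then _ (rec ())))
  from-deciding _ _ _ (out _ (else _ ()))
  from-deciding _ _ _ (inp _ (then _ (rec ())))
  from-deciding _ _ _ (inp _ (else _ ()))
  from-deciding _ _ _ (int (tau _ (then _ (rec ()))))
  from-deciding _ _ _ (int (tau _ (else _ ())))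
  from-deciding _ _ _ (int (sensRead _ (then _ (rec ())) _))
  from-deciding _ _ _ (int (sensRead _ (else _ ()) _))
  from-deciding {ξx} {ξu} {r} _ t≤ reading (int (actWrite _ (then 10<r (rec write)))) =
    -- The bound by `peak` serves as the one by `upper 5`: the terms of both sequences evaluate to
    -- the same rational, as do those of `lower 5` and `10 - ε`.
    monitoring (updated (_< 0ᵣ) ξx ξu on<0) (high-reading {ξx temp refl} {r} reading 10<r , t≤)
  from-deciding _ _ _ (int (actWrite _ (else _ ())))
  from-deciding _ _ _ (time inv (then 10<r _) urgent _) =
    contradiction (_ , actWrite inv (then 10<r (rec write))) urgent
  from-deciding {ξx} {ξu} {r} off _ reading (time _ (else r≤10 delay) _ (ξ , ξ∈evol , refl)) =
    sensing off (heating-step {ξx} {ξu} {ξ} {fromℕ 10 + ε} off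
      (low-reading {ξx temp refl} {r} reading r≤10)
      -- Both sides equal 11.5: this case determines `peak`.
      (seq-≤⇒≤ {fromℕ 10 + ε + 1ᵣ + δ} {peak} λ _ →
        from-yes (seq (fromℕ 10 + ε + 1ᵣ + δ) 0 ℚ.≤? seq peak 0))
      ξ∈evol)

  from-monitoring : ∀ {ξx ξu α M} → ξu cool refl < 0ᵣ →
    ξx temp refl ∈ ⦅ lower 5 , upper 5 ⟧ → engine ξx ξu ⋈ Monitor ⟶[ α ] M → Reachable M
  from-monitoring _ _ (out _ (rec ()))
  from-monitoring _ _ (inp _ (rec ()))
  from-monitoring _ _ (int (tau _ (rec ())))
  from-monitoring _ _ (int (sensRead _ (rec ()) _))
  from-monitoring _ _ (int (actWrite _ (rec ())))
  from-monitoring {ξx} {ξu} on band (time _ (rec delay) _ (ξ , ξ∈evol , refl)) =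
    -- The transition unfolds `fix` and consumes the first of the five ticks.
    cooling 4 on (cooling-step {ξx} {ξu} {ξ} 4 on band ξ∈evol)

  from-cooling : ∀ {ξx ξu α M} k → ξu cool refl < 0ᵣ →
    ξx temp refl ∈ ⦅ lower k , upper k ⟧ → engine ξx ξu ⋈ tick^ k Recheck ⟶[ α ] M →
    Reachable M
  from-cooling zero _ _ (out _ (rec ()))
  from-cooling zero _ _ (inp _ (rec ()))
  from-cooling zero _ _ (int (tau _ (rec ())))
  from-cooling {ξx} {ξu} zero on band (int (sensRead {r = r} _ (rec read) r∈)) =
    redeciding {r = r} on band (read-sensor⇒Reading ξx ξu {r = r} r∈)
  from-cooling zero _ _ (int (actWrite _ (rec ())))
  from-cooling {ξx} {ξu} zero _ _ (time inv _ urgent _) =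
    contradiction (_ , sensRead {r = ξx temp refl} inv (rec read) (can-read ξx ξu)) urgent
  from-cooling (suc _) _ _ (out _ ())
  from-cooling (suc _) _ _ (inp _ ())
  from-cooling (suc _) _ _ (int (tau _ ()))
  from-cooling (suc _) _ _ (int (sensRead _ () _))
  from-cooling (suc _) _ _ (int (actWrite _ ()))
  from-cooling {ξx} {ξu} (suc k) on band (time _ delay _ (ξ , ξ∈evol , refl)) =
    cooling k on (cooling-step {ξx} {ξu} {ξ} k on band ξ∈evol)

  from-redeciding : ∀ {ξx ξu r α M} → ξx temp refl ∈ ⦅ lower 0 , upper 0 ⟧ →
    Reading (ξx temp refl) r → engine ξx ξu ⋈ Redecide r ⟶[ α ] M → Reachable M
  from-redeciding {ξx} {r = r} (_ , t≤) reading (out _ (then 10<r _)) =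
    contradiction 10<r (cooled-reading {ξx temp refl} {r} t≤ reading)
  from-redeciding _ _ (out _ (else _ (rec ())))
  from-redeciding _ _ (inp _ (then _ (rec ())))
  from-redeciding _ _ (inp _ (else _ (rec ())))
  from-redeciding _ _ (int (tau _ (then _ (rec ()))))
  from-redeciding _ _ (int (tau _ (else _ (rec ()))))
  from-redeciding _ _ (int (sensRead _ (then _ (rec ())) _))
  from-redeciding _ _ (int (sensRead _ (else _ (rec ())) _))
  from-redeciding _ _ (int (actWrite _ (then _ (rec ()))))
  from-redeciding {ξx} {ξu} (_ , t≤) _ (int (actWrite _ (else _ (rec write)))) =
    switched-off (updated (0ᵣ ≤_) ξx ξu 0≤off) t≤
  -- A send alone gives no τ-transition, so urgency cannot refute this case; the temperature band
  -- does.
  from-redeciding {ξx} {r = r} (_ , t≤) reading (time _ (then 10<r _) _ _) =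
    contradiction 10<r (cooled-reading {ξx temp refl} {r} t≤ reading)
  from-redeciding _ _ (time inv (else r≤10 _) urgent _) =
    contradiction (_ , actWrite inv (else r≤10 (rec write))) urgent

  from-switched-off : ∀ {ξx ξu α M} → 0ᵣ ≤ ξu cool refl → ξx temp refl ≤ upper 0 →
    engine ξx ξu ⋈ tick∙ Ctrl ⟶[ α ] M → Reachable M
  from-switched-off _ _ (out _ ())
  from-switched-off _ _ (inp _ ())
  from-switched-off _ _ (int (tau _ ()))
  from-switched-off _ _ (int (sensRead _ () _))
  from-switched-off _ _ (int (actWrite _ ()))
  from-switched-off {ξx} {ξu} off t≤ (time _ delay _ (ξ , ξ∈evol , refl)) =
    sensing off (heating-step {ξx} {ξu} {ξ} {upper 0} off t≤
      -- Here 9.9 is compared with 11.5.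
      (seq-≤⇒≤ {upper 0 + 1ᵣ + δ} {peak} λ _ →
        from-yes (seq (upper 0 + 1ᵣ + δ) 0 ℚ.≤? seq peak 0))
      ξ∈evol)

  step-reachable : ∀ {M α M′} → Reachable M → M ⟶[ α ] M′ → Reachable M′
  step-reachable (sensing off t≤)                    = from-sensing off t≤
  step-reachable (deciding {r = r} off t≤ reading)   = from-deciding {r = r} off t≤ reading
  step-reachable (monitoring on band)                = from-monitoring on band
  step-reachable (cooling k on band)                 = from-cooling k on band
  step-reachable (redeciding {r = r} _ band reading) = from-redeciding {r = r} band reading
  step-reachable (switched-off off t≤)               = from-switched-off off t≤

  -- From the invariant to the bounds at each write.

  source-reachable : ∀ {M αs M′ M₁ α M₂} {trace : M ⟶*[ αs ] M′} {step : M₁ ⟶[ α ] M₂} →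
    Reachable M → step ∈ᵗ trace → Reachable M₁
  source-reachable reachable here = reachable
  source-reachable reachable (there {s′ = s′} step∈) =
    source-reachable (step-reachable reachable s′) step∈

  -- The written value is left general because `on` and `off` are abstract reals that matching could
  -- not tell apart; `on≢off` selects the disjunct afterwards.
  write-bounds : ∀ {E P P′ a r} → Reachable (E ⋈ P) → P —[ write a (real r) ]→ P′ →
    (r ≡ on × tempOf (E ⋈ P) ∈ ⦅ lower 5 , upper 5 ⟧) ⊎
    (r ≡ off × tempOf (E ⋈ P) ∈ ⦅ lower 0 , upper 0 ⟧)
  write-bounds (sensing _ _) (rec (rec ()))
  write-bounds (deciding {ξx} {r = r} _ t≤ reading) (then 10<r (rec write)) =
    inj₁ (refl , high-reading {ξx temp refl} {r} reading 10<r , t≤)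
  write-bounds (deciding _ _ _) (else _ ())
  write-bounds (monitoring _ _) (rec ())
  write-bounds (cooling zero _ _) (rec ())
  write-bounds (cooling (suc _) _ _) ()
  write-bounds (redeciding _ _ _) (then _ (rec ()))
  write-bounds (redeciding _ band _) (else _ (rec write)) = inj₂ (refl , band)
  write-bounds (switched-off _ _) ()

  on≢off : on ≢ off
  on≢off on≡off = 0≤off (subst (_< 0ᵣ) on≡off on<0)

  on-bounds : ∀ {M₁ α M₂} {step : M₁ ⟶[ α ] M₂} → Reachable M₁ →
    Performs-write cool on step → tempOf M₁ ∈ ⦅ lower 5 , upper 5 ⟧
  on-bounds reachable (actWrite {p = p}) =
    [ proj₂ , (λ (on≡off , _) → contradiction on≡off on≢off) ]′ (write-bounds reachable p)

  off-bounds : ∀ {M₁ α M₂} {step : M₁ ⟶[ α ] M₂} → Reachable M₁ →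
    Performs-write cool off step → tempOf M₁ ∈ ⦅ lower 0 , upper 0 ⟧
  off-bounds reachable (actWrite {p = p}) =
    [ (λ (off≡on , _) → contradiction (sym off≡on) on≢off) , proj₂ ]′ (write-bounds reachable p)

  start-reachable : Reachable Eng
  start-reachable = sensing 0≤off
    (seq-≤⇒≤ {0ᵣ} {peak} λ _ → from-yes (seq 0ᵣ 0 ℚ.≤? seq peak 0))

proposition11 : (names : Names) (symbols : EngineSymbols names) →
    let open Engine names symbols in
    ∀ {αs : List Action} {M : CPS} (trace : Eng ⟶*[ αs ] M)
    {M₁ : CPS} {α : Action} {M₂ : CPS} (step : M₁ ⟶[ α ] M₂) → step ∈ᵗ trace →
    (Performs-write cool on step →
    tempOf M₁ ∈ ⦅ fromℕ 10 - ε , fromℕ 11 + ε + δ ⟧)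
    ×
    (Performs-write cool off step →
    tempOf M₁ ∈ ⦅ fromℕ 10 - ε - 5 · (1ᵣ + δ) , fromℕ 11 + ε + δ - 5 · (1ᵣ - δ) ⟧)
-- The five steps added in `lower 5` and `upper 5` cancel the subtracted multiples by evaluation,
-- giving the switch-on interval; index 0 is the switch-off interval verbatim.
proposition11 names symbols trace step step∈ = on-bounds reachable , off-bounds reachable
  where
  open Behaviour names symbols
  reachable = source-reachable start-reachable step∈
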